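{- For each of the following increment sequences $h_1>\cdots>h_p=1$, the average number of inversions of Shellsort on $n$ keys is $\Omega(n\log n)$ as $n\to\infty$: (a) (Papernov–Stasevich) $p=\lfloor\log n\rfloor$ and $h_k=\lfloor n/2^k\rfloor+1$ for $1\le k<p$, with last increment $h_p=1$; (b) (Hibbard) the numbers $2^k-1$ ($k\ge1$) that are less than $n$, in decreasing order; (c) (Pratt's logarithmic sequence) the numbers $(3^k-1)/2$ ($k\ge1$) that are less than $n$, in decreasing order; (d) (Shell) $h_k=\lfloor n/2^k\rfloor$ for $1\le k\le p=\lfloor\log n\rfloor$.
   Context: $\log$ denotes the binary logarithm. Shellsort: a list of $n$ keys, given as a permutation $\sigma_0$ of $1,\ldots,n$, is sorted in place in $p$ passes using an increment sequence of integers $h_1,\ldots,h_p$ with $n>h_1>\cdots>h_p=1$. In pass $k$ the current list $\sigma_{k-1}$ is divided into $h_k$ sublists ($h_k$-chains); the $h$th one ($1\le h\le h_k$) consists, in order, of the keys in the positions $j\in\{1,\ldots,n\}$ with $j\equiv h \pmod{h_k}$. Each $h_k$-chain is sorted in increasing order by straightforward insertion sort: for $i=2,3,\ldots$ the $i$th key of the chain is repeatedly swapped with the key immediately preceding it in the chain as long as that preceding key is larger. Then the $j$th key of the $h$th sorted chain is in position $h+(j-1)h_k$ of the resulting list $\sigma_k$. After pass $p$ the list is $\sigma_p=12\ldots n$. An inversion is one swap of two keys adjacent in an $h_k$-chain made in this insertion sort. The number of inversions on input $\sigma_0$ is the total number of such swaps over all chains and all passes. The average number of inversions is the arithmetic mean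 of this number over all $n!$ input permutations. -}

module Defs where

open import Data.Fin.Base using (Fin; zero; suc; toℕ; punchIn)
open import Data.Fin.Permutation using (Permutation′; _⟨$⟩ʳ_; _∘ₚ_; _≈_; id; transpose; insert; remove; insert-remove; insert-punchIn)
import Data.Fin.Properties as Fin
open import Data.Integer.Base using (+_; ∣_∣)
open import Data.List.Base using (List; []; _∷_; _++_; [_]; map; filter; foldl; length; upTo; reverse; allFin; cartesianProductWith)
open import Data.List.Membership.Propositional.Properties using (∈-allFin)
open import Data.List.Properties using (length-map; length-++; length-tabulate)
open import Data.List.Relation.Unary.Any using (Any; here)
open import Data.List.Relation.Unary.Any.Properties using (cartesianProductWith⁺)
open import Data.Nat.Base using (ℕ; zero; suc; _+_; _*_; _∸_; _^_; _!; _≤_; ∣_-_∣)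
open import Data.Nat.DivMod using (_/_)
open import Data.Nat.Divisibility using (_∣?_)
open import Data.Nat.ListAction using (sum)
open import Data.Nat.Logarithm using (⌊log₂_⌋)
open import Data.Nat.Properties using (_<?_; m^n≢0; _!≢0)
open import Data.Product.Base using (_×_; _,_; proj₂; Σ-syntax)
open import Data.Rational.Unnormalised.Base as ℚᵘ using (ℚᵘ; Positive; ↥_; ↧ₙ_)
open import Relation.Binary.PropositionalEquality using (_≡_; refl; trans; cong; cong₂; module ≡-Reasoning)
open import Relation.Nullary using (yes; no)

-- Positions and keys are numbered from 0, so a list of n keys is a
-- permutation σ of Fin n whose key in position i is σ ⟨$⟩ʳ i.
-- A state is the current list with the number of swaps made so far.
State : ℕ → Set
State n = Permutation′ n × ℕ

-- The key in position p moves down its chain.  The list holds the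
-- positions of the chain that precede p, the nearest one first.
sink : ∀ {n} → List (Fin n) → Fin n → State n → State n
sink []       p s       = s
sink (q ∷ qs) p (σ , c) with (σ ⟨$⟩ʳ p) Fin.<? (σ ⟨$⟩ʳ q)
... | yes _ = sink qs q (transpose q p ∘ₚ σ , suc c)
... | no  _ = σ , c

-- In insertionSort done todo s, the positions in done are already sorted
-- and are listed in reverse order.
insertionSort : ∀ {n} → List (Fin n) → List (Fin n) → State n → State n
insertionSort done []       s = s
insertionSort done (p ∷ ps) s = insertionSort (p ∷ done) ps (sink done p s)

-- The positions congruent to r modulo h, in increasing order.
chain : ∀ {n} → ℕ → ℕ → List (Fin n)
chain {n} h r = filter (λ i → h ∣? ∣ toℕ i - r ∣) (allFin n)

pass : ∀ {n} → State n → ℕ → State n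
pass s h = foldl (λ t r → insertionSort [] (chain h r) t) s (upTo h)

shellsort : ∀ {n} → List ℕ → Permutation′ n → State n
shellsort hs σ = foldl pass (σ , 0) hs

inversions : ∀ {n} → List ℕ → Permutation′ n → ℕ
inversions hs σ = proj₂ (shellsort hs σ)

-- Every permutation is listed, and exactly once because the list has
-- length n !: see permutations-complete and length-permutations.
permutations : ∀ n → List (Permutation′ n)
permutations zero    = [ id ]
permutations (suc n) = cartesianProductWith (insert zero) (allFin (suc n)) (permutations n)

averageInversions : ∀ n → List ℕ → ℚᵘ
averageInversions n hs = (+ sum (map (inversions hs) (permutations n)) ℚᵘ./ n !) {{n !≢0}}

-- The real inequality r · log₂ n ≤ q, for rationals r , q ≥ 0 and n ≥ 1:
-- (a / b) · log₂ n ≤ c / d  iff  n ^ (a * d) ≤ 2 ^ (c * b).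
_·log₂_≤_ : ℚᵘ → ℕ → ℚᵘ → Set
r ·log₂ n ≤ q = n ^ (∣ ↥ r ∣ * ↧ₙ q) ≤ 2 ^ (∣ ↥ q ∣ * ↧ₙ r)

-- f n = Ω(n log₂ n) for a nonnegative f.  A rational c loses no generality,
-- since below every positive real there is a positive rational.
Ω[n·log₂n] : (ℕ → ℚᵘ) → Set
Ω[n·log₂n] f =
  Σ[ c ∈ ℚᵘ ] Positive c × (Σ[ N ∈ ℕ ] (∀ n → N ≤ n → (c ℚᵘ.* (+ n ℚᵘ./ 1)) ·log₂ n ≤ f n))

[1⋯_] : ℕ → List ℕ
[1⋯ m ] = map suc (upTo m)

⌊_/2^_⌋ : ℕ → ℕ → ℕ
⌊ n /2^ k ⌋ = (n / 2 ^ k) {{m^n≢0 2 k}}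

papernovStasevich : ℕ → List ℕ
papernovStasevich n = map (λ k → ⌊ n /2^ k ⌋ + 1) [1⋯ ⌊log₂ n ⌋ ∸ 1 ] ++ [ 1 ]

-- In hibbard and pratt the k-th number is at least k, so the numbers
-- below n all have k ≤ n.
hibbard : ℕ → List ℕ
hibbard n = reverse (filter (_<? n) (map (λ k → 2 ^ k ∸ 1) [1⋯ n ]))

pratt : ℕ → List ℕ
pratt n = reverse (filter (_<? n) (map (λ k → (3 ^ k ∸ 1) / 2) [1⋯ n ]))

shell : ℕ → List ℕ
shell n = map (λ k → ⌊ n /2^ k ⌋) [1⋯ ⌊log₂ n ⌋ ]

length-permutations : ∀ n → length (permutations n) ≡ n !
length-permutations zero    = refl
length-permutations (suc n) =
  trans (length-product (allFin (suc n)))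
        (cong₂ _*_ (length-tabulate {n = suc n} (λ i → i)) (length-permutations n))
  where
  length-product : ∀ (is : List (Fin (suc n))) →
    length (cartesianProductWith (insert zero) is (permutations n)) ≡ length is * length (permutations n)
  length-product []       = refl
  length-product (i ∷ is) =
    trans (length-++ (map (insert zero i) (permutations n)))
          (cong₂ _+_ (length-map (insert zero i) (permutations n)) (length-product is))

permutations-complete : ∀ {n} (σ : Permutation′ n) → Any (σ ≈_) (permutations n)
permutations-complete {zero}  σ = here λ ()
permutations-complete {suc n} σ =
  cartesianProductWith⁺ (insert zero) agree (∈-allFin (σ ⟨$⟩ʳ zero)) (permutations-complete (remove zero σ))
  where
  open ≡-Reasoning
  agree : ∀ {j τ} → σ ⟨$⟩ʳ zero ≡ j → remove zero σ ≈ τ → σ ≈ insert zero j τ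
  agree refl eq zero            = refl
  agree {τ = τ} refl eq (suc k) = begin
    σ ⟨$⟩ʳ suc k                                           ≡⟨ insert-remove zero σ (suc k) ⟨
    insert zero (σ ⟨$⟩ʳ zero) (remove zero σ) ⟨$⟩ʳ suc k   ≡⟨ insert-punchIn zero (σ ⟨$⟩ʳ zero) (remove zero σ) k ⟩
    punchIn (σ ⟨$⟩ʳ zero) (remove zero σ ⟨$⟩ʳ k)           ≡⟨ cong (punchIn (σ ⟨$⟩ʳ zero)) (eq k) ⟩
    punchIn (σ ⟨$⟩ʳ zero) (τ ⟨$⟩ʳ k)                       ≡⟨ insert-punchIn zero (σ ⟨$⟩ʳ zero) τ k ⟨
    insert zero (σ ⟨$⟩ʳ zero) τ ⟨$⟩ʳ suc k                 ∎

{-# OPTIONS --safe #-}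
-- Shellsort on n keys makes at most one insertion per key and pass, and the numbers of swaps made
-- by the individual insertions determine the input, since the output is always the identity and
-- every swap can be undone.  If there are z insertions, at most (16/15)^z · 16^t vectors of swap
-- numbers have sum at most t.  With at most 1 + log n passes and t = (n log n)/20 this is at
-- most n!/2 for large n, so that half of the inputs need more than t inversions.  All four sequences
-- have at most 1 + log n increments and end with 1, and nothing else about them matters.
module Submission where

open import Algebra.Properties.CommutativeSemigroup using (x∙yz≈y∙xz)
open import Data.Bool.Base using (true; false)
open import Data.Fin.Base as Fin using (Fin; zero; suc; toℕ; inject₁)
open import Data.Fin.Induction using (<-weakInduction)
open import Data.Fin.Permutation using (Permutation′; _⟨$⟩ʳ_; _⟨$⟩ˡ_; _∘ₚ_; _≈_; transpose; insert; insert-punchIn; inverseˡ; inverseʳ)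
import Data.Fin.Properties as Fin
open import Data.Integer.Base as ℤ using (∣_∣)
import Data.Integer.Properties as ℤ
open import Data.List.Base hiding (sum; last)
open import Data.List.Membership.Propositional using (_∈_)
open import Data.List.Membership.Propositional.Properties
open import Data.List.Properties
open import Data.List.Relation.Binary.Subset.Propositional using (_⊆_)
open import Data.List.Relation.Unary.All as All using (All; []; _∷_)
import Data.List.Relation.Unary.All.Properties as All
open import Data.List.Relation.Unary.AllPairs as AllPairs using (AllPairs; []; _∷_)
import Data.List.Relation.Unary.AllPairs.Properties as AllPairs
open import Data.List.Relation.Unary.Any using (here; index)
import Data.List.Relation.Unary.Any.Properties as Any
open import Data.List.Relation.Unary.Unique.Propositional using (Unique)
import Data.List.Relation.Unary.Unique.Propositional.Properties as Unique
import Data.List.Relation.Unary.Unique.Setoid.Properties as UniqueSetoid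
open import Data.Nat.Base hiding (_/_; _%_)
open import Data.Nat.DivMod
open import Data.Nat.Divisibility
open import Data.Nat.ListAction using (sum)
open import Data.Nat.Logarithm
open import Data.Nat.Properties
open import Data.Nat.Tactic.RingSolver using (solve-∀)
open import Data.Product.Base using (_×_; _,_; proj₁; proj₂; ∃-syntax)
open import Data.Rational.Unnormalised.Base as ℚᵘ using (mkℚᵘ)
import Data.Rational.Unnormalised.Properties as ℚᵘ
open import Data.Sum.Base using (inj₁; inj₂)
open import Data.Vec.Base as Vec using (Vec; []; _∷_)
import Data.Vec.Properties as Vec
open import Function.Base using (_∘_; id; flip)
open import Level using (Level)
open import Relation.Binary.Bundles using (Setoid)
import Relation.Binary.Construct.On as On
open import Relation.Binary.Core using (Rel)
open import Relation.Binary.Definitions using (tri<; tri≈; tri>)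
open import Relation.Binary.PropositionalEquality hiding ([_])
open import Relation.Nullary
open import Relation.Unary using (Decidable)
open import Defs

private
  variable
    a ℓ : Level
    A : Set a
    n : ℕ

-- Lists: pairwise relations, counting without repetition, folds

allPairs-lookup : ∀ {R : Rel A ℓ} {xs} → AllPairs R xs → ∀ {i j} → i Fin.< j → R (lookup xs i) (lookup xs j)
allPairs-lookup (Rx ∷ _)  {zero}  {suc j} _         = All.lookup Rx (∈-lookup j)
allPairs-lookup (_ ∷ Rxs) {suc i} {suc j} (s≤s i<j) = allPairs-lookup Rxs i<j

allPairs-tabulate⁻ : ∀ {R : Rel A ℓ} {f : Fin n → A} → AllPairs R (tabulate f) → ∀ {i j} → i Fin.< j → R (f i) (f j)
allPairs-tabulate⁻ (Rx ∷ _)  {zero}  {suc j} _         = All.tabulate⁻ Rx j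
allPairs-tabulate⁻ (_ ∷ Rxs) {suc i} {suc j} (s≤s i<j) = allPairs-tabulate⁻ Rxs i<j

allPairs-reverse : ∀ {R : Rel A ℓ} {xs} → AllPairs R xs → AllPairs (flip R) (reverse xs)
allPairs-reverse []                        = []
allPairs-reverse {xs = x ∷ xs} (Rx ∷ Rxs) rewrite unfold-reverse x xs =
  AllPairs.++⁺ (allPairs-reverse Rxs) ([] ∷ [])
    (All.tabulate λ y∈ → All.lookup Rx (Any.reverse⁻ y∈) ∷ [])

lookup-injective : ∀ {xs : List A} → Unique xs → ∀ {i j} → lookup xs i ≡ lookup xs j → i ≡ j
lookup-injective xs! {i} {j} eq with Fin.<-cmp i j
... | tri< i<j _ _ = contradiction eq (allPairs-lookup xs! i<j)
... | tri≈ _ i≡j _ = i≡j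
... | tri> _ _ j<i = contradiction (sym eq) (allPairs-lookup xs! j<i)

-- Pigeonhole: sending each index of `xs` to an index of the same entry in `ys` is injective.
unique-⊆⇒length-≤ : ∀ {xs ys : List A} → Unique xs → xs ⊆ ys → length xs ≤ length ys
unique-⊆⇒length-≤ {xs = xs} {ys} xs! xs⊆ys = Fin.injective⇒≤ {f = position} λ {i} {j} eq →
  lookup-injective xs! (trans (Any.lookup-index (xs⊆ys (∈-lookup i)))
    (trans (cong (lookup ys) eq) (sym (Any.lookup-index (xs⊆ys (∈-lookup j))))))
  where
  position : Fin (length xs) → Fin (length ys)
  position i = index (xs⊆ys (∈-lookup i))

foldl-concatMap : ∀ {b c} {B : Set b} {C : Set c} (f : C → B → C) (g : A → List B) x ys →
  foldl f x (concatMap g ys) ≡ foldl (λ z y → foldl f z (g y)) x ys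
foldl-concatMap f g x []       = refl
foldl-concatMap f g x (y ∷ ys) = trans (foldl-++ f x (g y) (concatMap g ys)) (foldl-concatMap f g _ ys)

filter-map : ∀ {A B : Set} {P : B → Set} (P? : Decidable P) (f : A → B) xs →
  filter P? (map f xs) ≡ map f (filter (P? ∘ f) xs)
filter-map P? f []       = refl
filter-map P? f (x ∷ xs) with does (P? (f x))
... | true  = cong (f x ∷_) (filter-map P? f xs)
... | false = filter-map P? f xs

-- Shellsort as a sequence of sinks

-- Which positions are sunk, and along which predecessors, depends only on `n` and the increments.
-- So one fixed sequence of sinks serves all inputs, and only the swap numbers vary with the keys.
Sinks : ℕ → Set
Sinks n = List (List (Fin n) × Fin n)

perform : State n → List (Fin n) × Fin n → State n
perform s (qs , p) = sink qs p s

insertionSinks : List (Fin n) → List (Fin n) → Sinks n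
insertionSinks done []       = []
insertionSinks done (p ∷ ps) = (done , p) ∷ insertionSinks (p ∷ done) ps

passSinks : ℕ → Sinks n
passSinks h = concatMap (λ r → insertionSinks [] (chain h r)) (upTo h)

shellsortSinks : List ℕ → Sinks n
shellsortSinks = concatMap passSinks

perform-insertionSinks : ∀ done ps (s : State n) → foldl perform s (insertionSinks done ps) ≡ insertionSort done ps s
perform-insertionSinks done []       s = refl
perform-insertionSinks done (p ∷ ps) s = perform-insertionSinks (p ∷ done) ps (sink done p s)

perform-passSinks : ∀ h (s : State n) → foldl perform s (passSinks h) ≡ pass s h
perform-passSinks h s = trans (foldl-concatMap perform (λ r → insertionSinks [] (chain h r)) s (upTo h))
  (foldl-cong (λ t r → perform-insertionSinks [] (chain h r) t) s (upTo h))

perform-shellsortSinks : ∀ hs (σ : Permutation′ n) → foldl perform (σ , 0) (shellsortSinks hs) ≡ shellsort hs σ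
perform-shellsortSinks hs σ = trans (foldl-concatMap perform passSinks (σ , 0) hs)
  (foldl-cong (λ t h → perform-passSinks h t) (σ , 0) hs)

length-insertionSinks : ∀ (done ps : List (Fin n)) → length (insertionSinks done ps) ≡ length ps
length-insertionSinks done []       = refl
length-insertionSinks done (p ∷ ps) = cong suc (length-insertionSinks (p ∷ done) ps)

length-concatMap : ∀ {b c} {B : Set b} {C : Set c} {f : A → List B} {g : A → List C} →
  (∀ x → length (f x) ≡ length (g x)) → ∀ xs → length (concatMap f xs) ≡ length (concatMap g xs)
length-concatMap eq []       = refl
length-concatMap {f = f} {g} eq (x ∷ xs) = trans (length-++ (f x))
  (trans (cong₂ _+_ (eq x) (length-concatMap eq xs)) (sym (length-++ (g x))))

-- This makes chains with different `r` disjoint. A position below `r` is impossible, because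
-- `r ∸ toℕ i` would be a positive multiple of `h` that is at most `r < h`.
∈-chain⇒%≡ : ∀ {h r} {i : Fin n} .{{_ : NonZero h}} → r < h → i ∈ chain h r → toℕ i % h ≡ r
∈-chain⇒%≡ {h = h} {r} {i} r<h i∈ with ≤-total r (toℕ i) | proj₂ (∈-filter⁻ (λ j → h ∣? ∣ toℕ j - r ∣) {xs = allFin _} i∈)
... | inj₁ r≤i | h∣ with divides k eq ← subst (h ∣_) (m≤n⇒∣n-m∣≡n∸m r≤i) h∣ = begin
  toℕ i % h            ≡⟨ cong (_% h) (m+[n∸m]≡n r≤i) ⟨
  (r + (toℕ i ∸ r)) % h ≡⟨ cong (λ d → (r + d) % h) eq ⟩
  (r + k * h) % h      ≡⟨ [m+kn]%n≡m%n r k h ⟩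
  r % h                ≡⟨ m<n⇒m%n≡m r<h ⟩
  r                    ∎
  where open ≡-Reasoning
... | inj₂ i≤r | h∣ with r ∸ toℕ i in eq | subst (h ∣_) (m≤n⇒∣m-n∣≡n∸m i≤r) h∣
...   | zero  | _  = trans (cong (_% h) (≤-antisym i≤r (m∸n≡0⇒m≤n eq))) (m<n⇒m%n≡m r<h)
...   | suc d | h∣d = contradiction (≤-trans (≤-trans (∣⇒≤ h∣d) (≤-reflexive (sym eq))) (m∸n≤m r (toℕ i))) (<⇒≱ r<h)

-- Each position occurs in at most one chain of the pass, so the concatenated chains have no
-- repetition and fit into `allFin n`.
length-passSinks : ∀ n h → length (passSinks {n} h) ≤ n
length-passSinks n zero      = z≤n
length-passSinks n h@(suc _) = begin
  length (passSinks {n} h)              ≡⟨ length-concatMap {f = λ r → insertionSinks [] (chain {n} h r)} {chain {n} h}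
                                                (λ r → length-insertionSinks [] (chain {n} h r)) (upTo h) ⟩
  length (concatMap (chain {n} h) (upTo h)) ≤⟨ unique-⊆⇒length-≤ unique (λ {i} _ → ∈-allFin i) ⟩
  length (allFin n)                     ≡⟨ length-tabulate id ⟩
  n                                     ∎
  where
  open ≤-Reasoning
  unique : Unique (concatMap (chain {n} h) (upTo h))
  unique = Unique.concat⁺
    (All.map⁺ (All.tabulate λ {r} _ → Unique.filter⁺ (λ i → h ∣? ∣ toℕ i - r ∣) (Unique.allFin⁺ n)))
    (AllPairs.map⁺ (AllPairs.applyUpTo⁺₁ id h λ {r} {r′} r<r′ r′<h (∈r , ∈r′) →
      <⇒≢ r<r′ (trans (sym (∈-chain⇒%≡ (<-trans r<r′ r′<h) ∈r)) (∈-chain⇒%≡ r′<h ∈r′))))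

length-shellsortSinks : ∀ n hs → length (shellsortSinks {n} hs) ≤ length hs * n
length-shellsortSinks n []       = z≤n
length-shellsortSinks n (h ∷ hs) = begin
  length (passSinks h ++ shellsortSinks hs)           ≡⟨ length-++ (passSinks {n} h) ⟩
  length (passSinks h) + length (shellsortSinks hs)   ≤⟨ +-mono-≤ (length-passSinks n h) (length-shellsortSinks n hs) ⟩
  n + length hs * n                                   ∎
  where open ≤-Reasoning

-- Swap numbers determine the input

swaps : List (Fin n) → Fin n → Permutation′ n → ℕ
swaps []       p σ = 0
swaps (q ∷ qs) p σ with (σ ⟨$⟩ʳ p) Fin.<? (σ ⟨$⟩ʳ q)
... | yes _ = suc (swaps qs q (transpose q p ∘ₚ σ))
... | no  _ = 0

sink-count : ∀ qs p (s : State n) → proj₂ (sink qs p s) ≡ proj₂ s + swaps qs p (proj₁ s)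
sink-count []       p (σ , c) = sym (+-identityʳ c)
sink-count (q ∷ qs) p (σ , c) with (σ ⟨$⟩ʳ p) Fin.<? (σ ⟨$⟩ʳ q)
... | yes _ = trans (sink-count qs q (transpose q p ∘ₚ σ , suc c)) (sym (+-suc c _))
... | no  _ = sym (+-identityʳ c)

∘ₚ-cancelˡ : ∀ (π : Permutation′ n) {σ τ : Permutation′ n} → π ∘ₚ σ ≈ π ∘ₚ τ → σ ≈ τ
∘ₚ-cancelˡ π {σ} {τ} eq i = subst (λ j → σ ⟨$⟩ʳ j ≡ τ ⟨$⟩ʳ j) (inverseʳ π) (eq (π ⟨$⟩ˡ i))

-- Equal swap numbers force both runs to swap or both to stop at each comparison. The swaps are then
-- the same transpositions of positions and can be cancelled.
sink-cancel : ∀ qs p (s t : State n) → swaps qs p (proj₁ s) ≡ swaps qs p (proj₁ t) →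
  proj₁ (sink qs p s) ≈ proj₁ (sink qs p t) → proj₁ s ≈ proj₁ t
sink-cancel []       p _       _       _   eq = eq
sink-cancel (q ∷ qs) p (σ , c) (τ , d) same eq
  with (σ ⟨$⟩ʳ p) Fin.<? (σ ⟨$⟩ʳ q) | (τ ⟨$⟩ʳ p) Fin.<? (τ ⟨$⟩ʳ q)
... | yes _ | yes _ = ∘ₚ-cancelˡ (transpose q p) {σ} {τ} (sink-cancel qs q _ _ (suc-injective same) eq)
... | no  _ | no  _ = eq

-- A generalised inversion table: for the single increment 1 it records, for each position, the
-- number of larger keys before it.
code : (ss : Sinks n) → State n → Vec ℕ (length ss)
code []              s = []
code ((qs , p) ∷ ss) s = swaps qs p (proj₁ s) ∷ code ss (sink qs p s)

sum-code : ∀ ss (s : State n) → proj₂ (foldl perform s ss) ≡ proj₂ s + Vec.sum (code ss s)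
sum-code []              s = sym (+-identityʳ _)
sum-code ((qs , p) ∷ ss) s = begin
  proj₂ (foldl perform (sink qs p s) ss)                               ≡⟨ sum-code ss (sink qs p s) ⟩
  proj₂ (sink qs p s) + Vec.sum (code ss (sink qs p s))                ≡⟨ cong (_+ Vec.sum (code ss (sink qs p s))) (sink-count qs p s) ⟩
  proj₂ s + swaps qs p (proj₁ s) + Vec.sum (code ss (sink qs p s))     ≡⟨ +-assoc (proj₂ s) _ _ ⟩
  proj₂ s + (swaps qs p (proj₁ s) + Vec.sum (code ss (sink qs p s)))   ∎
  where open ≡-Reasoning

-- The sinks are undone from the last to the first: the tail of the code leads back to the states
-- after the first sink, and its head then undoes that sink.
code-cancel : ∀ ss (s t : State n) → code ss s ≡ code ss t →
  proj₁ (foldl perform s ss) ≈ proj₁ (foldl perform t ss) → proj₁ s ≈ proj₁ t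
code-cancel []              s t _    eq = eq
code-cancel ((qs , p) ∷ ss) s t same eq = sink-cancel qs p s t (Vec.∷-injectiveˡ same)
  (code-cancel ss (sink qs p s) (sink qs p t) (Vec.∷-injectiveʳ same) eq)

-- Insertion sort on the whole list sorts it

keys : Permutation′ n → List (Fin n) → List (Fin n)
keys σ = map (σ ⟨$⟩ʳ_)

-- The effect of `sink` on the keys alone. The nearest predecessor comes first, so a sorted part is
-- descending.
insertKey : Fin n → List (Fin n) → List (Fin n)
insertKey x []       = x ∷ []
insertKey x (y ∷ ys) with x Fin.<? y
... | yes _ = y ∷ insertKey x ys
... | no  _ = x ∷ y ∷ ys

Descending : List (Fin n) → Set
Descending = AllPairs Fin._≥_

insertKey-All : ∀ {P : Fin n → Set} {x ys} → P x → All P ys → All P (insertKey x ys)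
insertKey-All {ys = []}     Px []         = Px ∷ []
insertKey-All {x = x} {y ∷ ys} Px (Py ∷ Pys) with x Fin.<? y
... | yes _ = Py ∷ insertKey-All Px Pys
... | no  _ = Px ∷ Py ∷ Pys

insertKey-descending : ∀ {x : Fin n} {ys} → Descending ys → Descending (insertKey x ys)
insertKey-descending []                                = [] ∷ []
insertKey-descending {x = x} {y ∷ ys} (y≥ys ∷ ys↓) with x Fin.<? y
... | yes x<y = insertKey-All (<⇒≤ x<y) y≥ys ∷ insertKey-descending ys↓
... | no  x≮y = (≮⇒≥ x≮y ∷ All.map (λ z≤y → ≤-trans z≤y (≮⇒≥ x≮y)) y≥ys) ∷ y≥ys ∷ ys↓

transpose-matchˡ : ∀ (i j : Fin n) → transpose i j ⟨$⟩ʳ i ≡ j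
transpose-matchˡ i j with i Fin.≟ i
... | yes _   = refl
... | no  i≢i = contradiction refl i≢i

transpose-matchʳ : ∀ {i j : Fin n} → i ≢ j → transpose i j ⟨$⟩ʳ j ≡ i
transpose-matchʳ {i = i} {j} i≢j with j Fin.≟ i
... | yes j≡i = j≡i
... | no  _   with j Fin.≟ j
...   | yes _   = refl
...   | no  j≢j = contradiction refl j≢j

transpose-mismatch : ∀ {i j k : Fin n} → i ≢ k → j ≢ k → transpose i j ⟨$⟩ʳ k ≡ k
transpose-mismatch {i = i} {j} {k} i≢k j≢k with k Fin.≟ i
... | yes k≡i = contradiction (sym k≡i) i≢k
... | no  _   with k Fin.≟ j
...   | yes k≡j = contradiction (sym k≡j) j≢k
...   | no  _   = refl

sink-outside : ∀ qs p (s : State n) {i} → All (_≢ i) (p ∷ qs) → proj₁ (sink qs p s) ⟨$⟩ʳ i ≡ proj₁ s ⟨$⟩ʳ i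
sink-outside []       p s       _                  = refl
sink-outside (q ∷ qs) p (σ , c) (p≢i ∷ q≢i ∷ qs≢i) with (σ ⟨$⟩ʳ p) Fin.<? (σ ⟨$⟩ʳ q)
... | yes _ = trans (sink-outside qs q (transpose q p ∘ₚ σ , suc c) (q≢i ∷ qs≢i)) (cong (σ ⟨$⟩ʳ_) (transpose-mismatch q≢i p≢i))
... | no  _ = refl

-- After a swap, `p` is never touched again because the positions are distinct, `q` holds the
-- sinking key, and `qs` still holds its old keys.
sink-keys : ∀ qs p (s : State n) → Unique (p ∷ qs) →
  keys (proj₁ (sink qs p s)) (p ∷ qs) ≡ insertKey (proj₁ s ⟨$⟩ʳ p) (keys (proj₁ s) qs)
sink-keys []       p s       _ = refl
sink-keys (q ∷ qs) p (σ , c) ((p≢q ∷ p≢qs) ∷ (q≢qs ∷ qs!)) with (σ ⟨$⟩ʳ p) Fin.<? (σ ⟨$⟩ʳ q)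
... | no  _ = refl
... | yes _ = cong₂ _∷_
  (trans (sink-outside qs q s′ (p≢q ∘ sym ∷ All.map (_∘ sym) p≢qs)) (cong (σ ⟨$⟩ʳ_) (transpose-matchʳ (p≢q ∘ sym))))
  (trans (sink-keys qs q s′ (q≢qs ∷ qs!)) (cong₂ insertKey (cong (σ ⟨$⟩ʳ_) (transpose-matchˡ q p)) (map-cong-local same)))
  where
  s′ = transpose q p ∘ₚ σ , suc c
  same : All (λ i → σ ⟨$⟩ʳ (transpose q p ⟨$⟩ʳ i) ≡ σ ⟨$⟩ʳ i) qs
  same = All.zipWith (λ (q≢i , p≢i) → cong (σ ⟨$⟩ʳ_) (transpose-mismatch q≢i p≢i)) (q≢qs , p≢qs)

ʳ++-unique⁻ : ∀ (xs : List A) {ys} → Unique (xs ʳ++ ys) → Unique ys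
ʳ++-unique⁻ []       ys! = ys!
ʳ++-unique⁻ (x ∷ xs) u with _ ∷ ys! ← ʳ++-unique⁻ xs u = ys!

-- The list `ps ʳ++ done` is invariant under the recursion, since `(p ∷ ps) ʳ++ done` reduces to
-- `ps ʳ++ (p ∷ done)`; hence `u` is passed on unchanged.
insertionSort-descending : ∀ done ps (s : State n) → Unique (ps ʳ++ done) →
  Descending (keys (proj₁ s) done) → Descending (keys (proj₁ (insertionSort done ps s)) (ps ʳ++ done))
insertionSort-descending done []       s _ done↓ = done↓
insertionSort-descending done (p ∷ ps) s u done↓ = insertionSort-descending (p ∷ done) ps (sink done p s) u
  (subst Descending (sym (sink-keys done p s (ʳ++-unique⁻ ps u))) (insertKey-descending done↓))

increasing⇒≤ : ∀ {m} {f : Fin n → Fin m} → (∀ {i j} → i Fin.< j → f i Fin.< f j) → ∀ i → i Fin.≤ f i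
increasing⇒≤ {n = suc _} {f = f} mono = <-weakInduction (λ i → i Fin.≤ f i) z≤n
  λ i i≤fi → ≤-trans (s≤s (subst (_≤ toℕ (f (inject₁ i))) (Fin.toℕ-inject₁ i) i≤fi)) (mono (s≤s (≤-reflexive (Fin.toℕ-inject₁ i))))

-- The inverse of `σ` is increasing too. Applying `increasing⇒≤` to `σ` at `i`, and to the inverse
-- at the image of `i`, gives both inequalities.
increasing⇒id : ∀ (σ : Permutation′ n) → (∀ {i j} → i Fin.< j → σ ⟨$⟩ʳ i Fin.< σ ⟨$⟩ʳ j) → ∀ i → σ ⟨$⟩ʳ i ≡ i
increasing⇒id {n} σ mono i = Fin.≤-antisym σi≤i (increasing⇒≤ mono i)
  where
  mono⁻¹ : ∀ {i j} → i Fin.< j → σ ⟨$⟩ˡ i Fin.< σ ⟨$⟩ˡ j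
  mono⁻¹ {i} {j} i<j with Fin.<-cmp (σ ⟨$⟩ˡ i) (σ ⟨$⟩ˡ j)
  ... | tri< lt _ _ = lt
  ... | tri≈ _ eq _ = contradiction (trans (sym (inverseʳ σ)) (trans (cong (σ ⟨$⟩ʳ_) eq) (inverseʳ σ))) (Fin.<⇒≢ i<j)
  ... | tri> _ _ gt = contradiction (subst₂ Fin._<_ (inverseʳ σ) (inverseʳ σ) (mono gt)) (Fin.<-asym i<j)

  σi≤i : σ ⟨$⟩ʳ i Fin.≤ i
  σi≤i = subst (σ ⟨$⟩ʳ i Fin.≤_) (inverseˡ σ) (increasing⇒≤ mono⁻¹ (σ ⟨$⟩ʳ i))

⟨$⟩ʳ-injective : ∀ (σ : Permutation′ n) {i j} → σ ⟨$⟩ʳ i ≡ σ ⟨$⟩ʳ j → i ≡ j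
⟨$⟩ʳ-injective σ eq = trans (sym (inverseˡ σ)) (trans (cong (σ ⟨$⟩ˡ_) eq) (inverseˡ σ))

-- For `h = 1` the only chain is the whole list. Insertion sort makes it weakly ascending, and
-- injectivity makes it strictly so.
pass-1-sorts : ∀ (s : State n) i → proj₁ (pass s 1) ⟨$⟩ʳ i ≡ i
pass-1-sorts {n} s rewrite filter-all (λ (i : Fin n) → 1 ∣? ∣ toℕ i - 0 ∣) (All.tabulate {xs = allFin n} λ _ → 1∣ _) =
  increasing⇒id σ λ {i} {j} i<j → Fin.≤∧≢⇒< (allPairs-tabulate⁻ ascending i<j) (Fin.<⇒≢ i<j ∘ ⟨$⟩ʳ-injective σ)
  where
  σ = proj₁ (insertionSort [] (allFin n) s)
  ascending : AllPairs Fin._≤_ (tabulate (σ ⟨$⟩ʳ_))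
  ascending = subst (AllPairs Fin._≤_)
    (trans (cong reverse (reverse-map (σ ⟨$⟩ʳ_) (allFin n))) (trans (reverse-involutive _) (map-tabulate id (σ ⟨$⟩ʳ_))))
    (allPairs-reverse (insertionSort-descending [] (allFin n) s
      (AllPairs.map (_∘ sym) (allPairs-reverse (Unique.allFin⁺ n))) []))

shellsort-sorts : ∀ hs (σ : Permutation′ n) i → proj₁ (shellsort (hs ++ [ 1 ]) σ) ⟨$⟩ʳ i ≡ i
shellsort-sorts hs σ i rewrite foldl-++ pass (σ , 0) hs [ 1 ] = pass-1-sorts (foldl pass (σ , 0) hs) i

-- Whatever the earlier passes do, the last increment 1 takes both inputs to the identity, which
-- supplies the common final list for `code-cancel`.
code-injective : ∀ hs (σ τ : Permutation′ n) →
  code (shellsortSinks (hs ++ [ 1 ])) (σ , 0) ≡ code (shellsortSinks (hs ++ [ 1 ])) (τ , 0) → σ ≈ τ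
code-injective {n} hs σ τ eq =
  code-cancel (shellsortSinks (hs ++ [ 1 ])) (σ , 0) (τ , 0) eq λ i → trans (sorted σ i) (sym (sorted τ i))
  where
  sorted : ∀ (ρ : Permutation′ n) i → proj₁ (foldl perform (ρ , 0) (shellsortSinks (hs ++ [ 1 ]))) ⟨$⟩ʳ i ≡ i
  sorted ρ i = trans (cong (λ s → proj₁ s ⟨$⟩ʳ i) (perform-shellsortSinks (hs ++ [ 1 ]) ρ)) (shellsort-sorts hs ρ i)

-- Counting inputs by their swap numbers

≈-setoid : ℕ → Setoid _ _
≈-setoid n = On.setoid (Fin n →-setoid Fin n) (_⟨$⟩ʳ_ {n} {n})

insert-injective : ∀ {i j} {σ τ : Permutation′ n} → insert zero i σ ≈ insert zero j τ → i ≡ j × σ ≈ τ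
insert-injective {σ = σ} {τ} eq with refl ← eq zero = refl , λ k → Fin.punchIn-injective _ _ _
  (trans (sym (insert-punchIn zero _ σ k)) (trans (eq (suc k)) (insert-punchIn zero _ τ k)))

-- Together with `code-injective` this lets list entries be counted by their codes.
permutations-unique : ∀ n → AllPairs (λ σ τ → ¬ σ ≈ τ) (permutations n)
permutations-unique zero    = [] ∷ []
permutations-unique (suc n) = UniqueSetoid.cartesianProductWith⁺
  (setoid (Fin (suc n))) (≈-setoid n) (≈-setoid (suc n)) (insert zero)
  (λ {i} {j} {σ} {τ} → insert-injective {i = i} {j} {σ} {τ}) (Unique.allFin⁺ (suc n)) (permutations-unique n)

incHead : ∀ {m} → Vec ℕ (suc m) → Vec ℕ (suc m)
incHead (x ∷ xs) = suc x ∷ xs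

-- The split is by whether the head is zero or positive. The lengths then obey the Pascal recursion
-- and are the binomial coefficients of `m + T` over `m`.
boundedVecs : ∀ m → ℕ → List (Vec ℕ m)
boundedVecs zero    T       = [ [] ]
boundedVecs (suc m) zero    = map (0 ∷_) (boundedVecs m zero)
boundedVecs (suc m) (suc T) = map (0 ∷_) (boundedVecs m (suc T)) ++ map incHead (boundedVecs (suc m) T)

∈-boundedVecs : ∀ {m T} (xs : Vec ℕ m) → Vec.sum xs ≤ T → xs ∈ boundedVecs m T
∈-boundedVecs         []           _         = here refl
∈-boundedVecs {T = zero}  (zero ∷ xs)  le       = ∈-map⁺ (0 ∷_) (∈-boundedVecs xs le)
∈-boundedVecs {T = suc T} (zero ∷ xs)  le       = ∈-++⁺ˡ (∈-map⁺ (0 ∷_) (∈-boundedVecs xs le))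
∈-boundedVecs {T = suc T} (suc x ∷ xs) (s≤s le) = ∈-++⁺ʳ _ (∈-map⁺ incHead (∈-boundedVecs (x ∷ xs) le))

-- The weights 1/16 and 15/16 sum to 1, so that they are compatible with the Pascal recursion.
length-boundedVecs : ∀ m (T : ℕ) → length (boundedVecs m T) * 15 ^ m ≤ 16 ^ m * 16 ^ T
length-boundedVecs zero    T       = ≤-trans (m^n>0 16 T) (≤-reflexive (sym (*-identityˡ _)))
length-boundedVecs (suc m) zero    = begin
  length (map (0 ∷_) (boundedVecs m 0)) * (15 * 15 ^ m) ≡⟨ cong (_* (15 * 15 ^ m)) (length-map _ (boundedVecs m 0)) ⟩
  l * (15 * 15 ^ m)  ≡⟨ x∙yz≈y∙xz *-commutativeSemigroup l 15 (15 ^ m) ⟩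
  15 * (l * 15 ^ m)  ≤⟨ *-mono-≤ (n≤1+n 15) (length-boundedVecs m 0) ⟩
  16 * (16 ^ m * 1)  ≡⟨ *-assoc 16 (16 ^ m) 1 ⟨
  16 * 16 ^ m * 1    ∎
  where
  open ≤-Reasoning
  l = length (boundedVecs m 0)
length-boundedVecs (suc m) (suc T) = begin
  length (map (0 ∷_) (boundedVecs m (suc T)) ++ map incHead (boundedVecs (suc m) T)) * (15 * 15 ^ m)
    ≡⟨ cong (_* (15 * 15 ^ m)) (trans (length-++ (map (0 ∷_) (boundedVecs m (suc T))))
         (cong₂ _+_ (length-map _ (boundedVecs m (suc T))) (length-map _ (boundedVecs (suc m) T)))) ⟩
  (l + l′) * (15 * 15 ^ m)                       ≡⟨ *-distribʳ-+ _ l l′ ⟩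
  l * (15 * 15 ^ m) + l′ * (15 * 15 ^ m)         ≡⟨ cong (_+ l′ * (15 * 15 ^ m)) (x∙yz≈y∙xz *-commutativeSemigroup l 15 (15 ^ m)) ⟩
  15 * (l * 15 ^ m) + l′ * (15 * 15 ^ m)         ≤⟨ +-mono-≤ (*-monoʳ-≤ 15 (length-boundedVecs m (suc T))) (length-boundedVecs (suc m) T) ⟩
  15 * (16 ^ m * (16 * 16 ^ T)) + 16 * 16 ^ m * 16 ^ T  ≡⟨ split (16 ^ m) (16 ^ T) ⟩
  16 * 16 ^ m * (16 * 16 ^ T)                    ∎
  where
  open ≤-Reasoning
  l  = length (boundedVecs m (suc T))
  l′ = length (boundedVecs (suc m) T)
  split : ∀ x y → 15 * (x * (16 * y)) + 16 * x * y ≡ 16 * x * (16 * y)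
  split = solve-∀

-- Markov's inequality without division: each entry is charged `suc t`, paid either by its own value
-- or by its place in the filtered list.
markov : ∀ {A : Set} (f : A → ℕ) t xs →
  suc t * length xs ≤ sum (map f xs) + suc t * length (filter (λ x → f x ≤? t) xs)
markov f t []       = ≤-refl
markov f t (x ∷ xs) with f x ≤? t | markov f t xs
... | yes fx≤t | ih rewrite filter-accept (λ x → f x ≤? t) {xs = xs} fx≤t = begin
  suc t * suc (length xs)              ≡⟨ *-suc (suc t) _ ⟩
  suc t + suc t * length xs            ≤⟨ +-mono-≤ (m≤n+m (suc t) (f x)) ih ⟩
  f x + suc t + (sum (map f xs) + suc t * k)  ≡⟨ reorder (f x) (suc t) (sum (map f xs)) k ⟩
  f x + sum (map f xs) + suc t * suc k ∎
  where
  open ≤-Reasoning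
  k = length (filter (λ x → f x ≤? t) xs)
  reorder : ∀ a b c k → a + b + (c + b * k) ≡ a + c + b * suc k
  reorder = solve-∀
... | no fx≰t | ih rewrite filter-reject (λ x → f x ≤? t) {xs = xs} fx≰t = begin
  suc t * suc (length xs)                  ≡⟨ *-suc (suc t) _ ⟩
  suc t + suc t * length xs                ≤⟨ +-mono-≤ (≰⇒> fx≰t) ih ⟩
  f x + (sum (map f xs) + _)               ≡⟨ +-assoc (f x) _ _ ⟨
  f x + sum (map f xs) + _                 ∎
  where open ≤-Reasoning

-- The code is injective on inputs and its sum is the number of inversions, so these inputs embed
-- into `boundedVecs (length ss) t`.
few-inversions : ∀ n hs t →
  let ss = shellsortSinks {n} (hs ++ [ 1 ]) in
  length (filter (λ σ → inversions (hs ++ [ 1 ]) σ ≤? t) (permutations n)) * 15 ^ length ss ≤ 16 ^ length ss * 16 ^ t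
few-inversions n hs t = ≤-trans (*-monoˡ-≤ (15 ^ length ss) few) (length-boundedVecs (length ss) t)
  where
  ss  = shellsortSinks {n} (hs ++ [ 1 ])
  few? = λ σ → inversions {n} (hs ++ [ 1 ]) σ ≤? t
  σs  = filter few? (permutations n)
  code′ : Permutation′ n → Vec ℕ (length ss)
  code′ σ = code ss (σ , 0)

  bounded : ∀ σ → inversions (hs ++ [ 1 ]) σ ≤ t → code′ σ ∈ boundedVecs (length ss) t
  bounded σ inv≤t = ∈-boundedVecs (code′ σ) (subst (_≤ t)
    (trans (cong proj₂ (sym (perform-shellsortSinks (hs ++ [ 1 ]) σ))) (sum-code ss (σ , 0))) inv≤t)

  few : length σs ≤ length (boundedVecs (length ss) t)
  few = subst (_≤ length (boundedVecs (length ss) t)) (length-map code′ σs) (unique-⊆⇒length-≤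
    (AllPairs.map⁺ (AllPairs.map (λ {σ} {τ} σ≉τ eq → σ≉τ (code-injective hs σ τ eq))
      (AllPairs.filter⁺ few? (permutations-unique n))))
    (λ v∈ → let σ , σ∈ , v≡ = ∈-map⁻ code′ v∈ in
      subst (_∈ _) (sym v≡) (bounded σ (proj₂ (∈-filter⁻ few? {xs = permutations n} σ∈)))))

-- The lower bound for at most 1 + log n passes

n<2^[1+⌊log₂n⌋] : ∀ n → n < 2 ^ suc ⌊log₂ n ⌋
n<2^[1+⌊log₂n⌋] n = ≰⇒> λ 2^1+L≤n →
  1+n≰n (subst (_≤ ⌊log₂ n ⌋) (⌊log₂[2^n]⌋≡n (suc ⌊log₂ n ⌋)) (⌊log₂⌋-mono-≤ 2^1+L≤n))

2*⌊n/2⌋≤n : ∀ n → 2 * ⌊ n /2⌋ ≤ n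
2*⌊n/2⌋≤n n = begin
  2 * ⌊ n /2⌋           ≡⟨ cong (⌊ n /2⌋ +_) (+-identityʳ _) ⟩
  ⌊ n /2⌋ + ⌊ n /2⌋     ≤⟨ +-monoʳ-≤ ⌊ n /2⌋ (⌊n/2⌋≤⌈n/2⌉ n) ⟩
  ⌊ n /2⌋ + ⌈ n /2⌉     ≡⟨ ⌊n/2⌋+⌈n/2⌉≡n n ⟩
  n                     ∎
  where open ≤-Reasoning

-- Having `l` as a variable allows induction on it: halving `n` lowers the logarithm by 1.
≤log₂⇒2^≤ : ∀ l n .{{_ : NonZero n}} → l ≤ ⌊log₂ n ⌋ → 2 ^ l ≤ n
≤log₂⇒2^≤ zero    n           _  = >-nonZero⁻¹ n
≤log₂⇒2^≤ (suc l) 1           ()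
≤log₂⇒2^≤ (suc l) n@(2+ m) l<L = ≤-trans
  (*-monoʳ-≤ 2 (≤log₂⇒2^≤ l ⌊ n /2⌋ (≤-trans (∸-monoˡ-≤ 1 l<L) (≤-reflexive (sym (⌊log₂⌊n/2⌋⌋≡⌊log₂n⌋∸1 n))))))
  (2*⌊n/2⌋≤n n)

2^⌊log₂n⌋≤n : ∀ n .{{_ : NonZero n}} → 2 ^ ⌊log₂ n ⌋ ≤ n
2^⌊log₂n⌋≤n n = ≤log₂⇒2^≤ ⌊log₂ n ⌋ n ≤-refl

m^k≤[k+m]! : ∀ m k → m ^ k ≤ (k + m) !
m^k≤[k+m]! m zero    = n≢0⇒n>0 (≢-nonZero⁻¹ (m !) {{m !≢0}})
m^k≤[k+m]! m (suc k) = *-mono-≤ (m≤n+m m (suc k)) (m^k≤[k+m]! m k)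

-- With `m = 2 ^ l` at most n/2, at least half of the factors of `n !` exceed `m`. Squaring avoids
-- halving `n` in the exponent.
2^[ln]≤[n!]² : ∀ l n → 2 ^ suc l ≤ n → 2 ^ (l * n) ≤ (n !) ^ 2
2^[ln]≤[n!]² l n 2m≤n = begin
  2 ^ (l * n)         ≤⟨ ^-monoʳ-≤ 2 (*-monoʳ-≤ l n≤k*2) ⟩
  2 ^ (l * (k * 2))   ≡⟨ ^-*-assoc 2 l (k * 2) ⟨
  m ^ (k * 2)         ≡⟨ ^-*-assoc m k 2 ⟨
  (m ^ k) ^ 2         ≤⟨ ^-monoˡ-≤ 2 (m^k≤[k+m]! m k) ⟩
  ((k + m) !) ^ 2     ≡⟨ cong (λ i → (i !) ^ 2) k+m≡n ⟩
  (n !) ^ 2           ∎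
  where
  open ≤-Reasoning
  m = 2 ^ l
  k = n ∸ m
  2m≡m+m : 2 * m ≡ m + m
  2m≡m+m = cong (m +_) (+-identityʳ m)
  m+m≤n : m + m ≤ n
  m+m≤n = subst (_≤ n) 2m≡m+m 2m≤n
  k+m≡n : k + m ≡ n
  k+m≡n = m∸n+n≡m (m+n≤o⇒m≤o m m+m≤n)
  n≤k*2 : n ≤ k * 2
  n≤k*2 = begin
    n      ≡⟨ k+m≡n ⟨
    k + m  ≤⟨ +-monoʳ-≤ k (m+n≤o⇒m≤o∸n m m+m≤n) ⟩
    k + k  ≡⟨ cong (k +_) (+-identityʳ k) ⟨
    2 * k  ≡⟨ *-comm 2 k ⟩
    k * 2  ∎

^-cancelˡ-≤ : ∀ k .{{_ : NonZero k}} {m n} → m ^ k ≤ n ^ k → m ≤ n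
^-cancelˡ-≤ k m^k≤n^k = ≮⇒≥ λ n<m → <⇒≱ (^-monoˡ-< k n<m) m^k≤n^k

^-distribʳ-* : ∀ m n k → (m * n) ^ k ≡ m ^ k * n ^ k
^-distribʳ-* m n zero    = refl
^-distribʳ-* m n (suc k) = trans (cong (m * n *_) (^-distribʳ-* m n k)) ([m*n]*[o*p]≡[m*o]*[n*p] m n (m ^ k) (n ^ k))

^-comm : ∀ m j k → (m ^ j) ^ k ≡ (m ^ k) ^ j
^-comm m j k = trans (^-*-assoc m j k) (trans (cong (m ^_) (*-comm j k)) (sym (^-*-assoc m k j)))

-- Tenth powers are compared because 16 ^ 10 ≤ 2 * 15 ^ 10.
half-factorial : ∀ l n z t c → 7 ≤ l → 2 ^ suc l ≤ n → z ≤ (2 + l) * n → 20 * t ≤ suc l * n →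
  c * 15 ^ z ≤ 16 ^ z * 16 ^ t → 2 * c ≤ n !
half-factorial l n z t c 7≤l 2^≤n z≤ t≤ c≤ =
  *-cancelʳ-≤ (2 * c) (n !) (15 ^ z) {{m^n≢0 15 z}} (^-cancelˡ-≤ 10 (begin
    (2 * c * 15 ^ z) ^ 10                           ≡⟨ cong (_^ 10) (*-assoc 2 c (15 ^ z)) ⟩
    (2 * (c * 15 ^ z)) ^ 10                         ≤⟨ ^-monoˡ-≤ 10 (*-monoʳ-≤ 2 c≤) ⟩
    (2 * (16 ^ z * 16 ^ t)) ^ 10                    ≡⟨ ^-distribʳ-* 2 (16 ^ z * 16 ^ t) 10 ⟩
    2 ^ 10 * (16 ^ z * 16 ^ t) ^ 10                 ≡⟨ cong (2 ^ 10 *_) (^-distribʳ-* (16 ^ z) (16 ^ t) 10) ⟩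
    2 ^ 10 * ((16 ^ z) ^ 10 * (16 ^ t) ^ 10)        ≤⟨ *-monoʳ-≤ (2 ^ 10) (*-mono-≤ 16≤15 (≤-reflexive 16^t)) ⟩
    2 ^ 10 * (2 ^ z * (15 ^ z) ^ 10 * 2 ^ (t * 40)) ≡⟨ reorder (2 ^ 10) (2 ^ z) ((15 ^ z) ^ 10) (2 ^ (t * 40)) ⟩
    2 ^ 10 * (2 ^ z * 2 ^ (t * 40)) * (15 ^ z) ^ 10 ≡⟨ cong (_* (15 ^ z) ^ 10) (trans (cong (2 ^ 10 *_) (sym (^-distribˡ-+-* 2 z (t * 40)))) (sym (^-distribˡ-+-* 2 10 (z + t * 40)))) ⟩
    2 ^ (10 + (z + t * 40)) * (15 ^ z) ^ 10         ≤⟨ *-monoˡ-≤ ((15 ^ z) ^ 10) (^-monoʳ-≤ 2 exponents) ⟩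
    2 ^ (l * n * 5) * (15 ^ z) ^ 10                 ≡⟨ cong (_* (15 ^ z) ^ 10) (^-*-assoc 2 (l * n) 5) ⟨
    (2 ^ (l * n)) ^ 5 * (15 ^ z) ^ 10               ≤⟨ *-monoˡ-≤ ((15 ^ z) ^ 10) (^-monoˡ-≤ 5 (2^[ln]≤[n!]² l n 2^≤n)) ⟩
    ((n !) ^ 2) ^ 5 * (15 ^ z) ^ 10                 ≡⟨ cong (_* (15 ^ z) ^ 10) (^-*-assoc (n !) 2 5) ⟩
    (n !) ^ 10 * (15 ^ z) ^ 10                      ≡⟨ ^-distribʳ-* (n !) (15 ^ z) 10 ⟨
    (n ! * 15 ^ z) ^ 10                             ∎))
  where
  open ≤-Reasoning
  reorder : ∀ a b c d → a * (b * c * d) ≡ a * (b * d) * c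
  reorder = solve-∀
  16≤15 : (16 ^ z) ^ 10 ≤ 2 ^ z * (15 ^ z) ^ 10
  16≤15 = begin
    (16 ^ z) ^ 10           ≡⟨ ^-comm 16 z 10 ⟩
    (16 ^ 10) ^ z           ≤⟨ ^-monoˡ-≤ z (≤ᵇ⇒≤ (16 ^ 10) (2 * 15 ^ 10) _) ⟩
    (2 * 15 ^ 10) ^ z       ≡⟨ ^-distribʳ-* 2 (15 ^ 10) z ⟩
    2 ^ z * (15 ^ 10) ^ z   ≡⟨ cong (2 ^ z *_) (^-comm 15 10 z) ⟩
    2 ^ z * (15 ^ z) ^ 10   ∎
  16^t : (16 ^ t) ^ 10 ≡ 2 ^ (t * 40)
  16^t = trans (^-comm 16 t 10) (trans (^-*-assoc 2 40 t) (cong (2 ^_) (*-comm 40 t)))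
  n≥1 : 1 ≤ n
  n≥1 = ≤-trans (m^n>0 2 (suc l)) 2^≤n
  -- The left side is at most (14 + 3l)n, and 14 + 3l ≤ 5l holds exactly for l ≥ 7.
  exponents : 10 + (z + t * 40) ≤ l * n * 5
  exponents = begin
    10 + (z + t * 40)                              ≡⟨ cong (λ u → 10 + (z + u)) (dbl t) ⟩
    10 + (z + 2 * (20 * t))                        ≤⟨ +-monoʳ-≤ 10 (+-mono-≤ z≤ (*-monoʳ-≤ 2 t≤)) ⟩
    10 + ((2 + l) * n + 2 * (suc l * n))           ≤⟨ +-monoˡ-≤ _ (*-monoʳ-≤ 10 n≥1) ⟩
    10 * n + ((2 + l) * n + 2 * (suc l * n))       ≡⟨ collect l n ⟩
    (2 * 7 + 3 * l) * n                            ≤⟨ *-monoˡ-≤ n (+-monoˡ-≤ (3 * l) (*-monoʳ-≤ 2 7≤l)) ⟩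
    (2 * l + 3 * l) * n                            ≡⟨ five l n ⟩
    l * n * 5                                      ∎
    where
    dbl : ∀ t → t * 40 ≡ 2 * (20 * t)
    dbl = solve-∀
    collect : ∀ l n → 10 * n + ((2 + l) * n + 2 * (suc l * n)) ≡ (2 * 7 + 3 * l) * n
    collect = solve-∀
    five : ∀ l n → (2 * l + 3 * l) * n ≡ l * n * 5
    five = solve-∀

-- At least half of the inputs need `suc t` or more inversions. As `t` is rounded down, `20 * suc t`
-- is at least the logarithm times `n`, and the half turns 20 into 40.
total-inversions : ∀ n hs → 256 ≤ n → length (hs ++ [ 1 ]) ≤ suc ⌊log₂ n ⌋ →
  ⌊log₂ n ⌋ * n * n ! ≤ 40 * sum (map (inversions (hs ++ [ 1 ])) (permutations n))
total-inversions n hs 256≤n p≤ with ⌊log₂ n ⌋ in log≡ | ⌊log₂⌋-mono-≤ 256≤n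
-- Since 256 = 2 ^ 8, the logarithm `suc l` is at least 8, which gives the `7 ≤ l` that
-- `half-factorial` asks for.
... | suc l | s≤s 7≤l = begin
  suc l * n * n !              ≤⟨ *-monoˡ-≤ (n !) L*n≤ ⟩
  20 * suc t * n !             ≡⟨ *-assoc 20 (suc t) (n !) ⟩
  20 * (suc t * n !)           ≤⟨ *-monoʳ-≤ 20 (+-cancelʳ-≤ (suc t * n !) (suc t * n !) (2 * S) twice) ⟩
  20 * (2 * S)                 ≡⟨ *-assoc 20 2 S ⟨
  40 * S                       ∎
  where
  open ≤-Reasoning
  instance
    _ : NonZero n
    _ = >-nonZero (≤-trans (s≤s z≤n) 256≤n)
  t = suc l * n / 20
  S = sum (map (inversions (hs ++ [ 1 ])) (permutations n))
  ss = shellsortSinks {n} (hs ++ [ 1 ])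
  c = length (filter (λ σ → inversions (hs ++ [ 1 ]) σ ≤? t) (permutations n))
  L*n≤ : suc l * n ≤ 20 * suc t
  L*n≤ = <⇒≤ (subst (suc l * n <_) (*-comm (suc t) 20) (m<[1+[m/n]]n (suc l * n)))
    where
    m<[1+[m/n]]n : ∀ m → m < suc (m / 20) * 20
    m<[1+[m/n]]n m = subst (_< suc (m / 20) * 20) (sym (m≡m%n+[m/n]*n m 20)) (+-monoˡ-< (m / 20 * 20) (m%n<n m 20))
  2c≤n! : 2 * c ≤ n !
  2c≤n! = half-factorial l n (length ss) t c 7≤l
    (subst (λ L → 2 ^ L ≤ n) log≡ (2^⌊log₂n⌋≤n n))
    (≤-trans (length-shellsortSinks n (hs ++ [ 1 ])) (*-monoˡ-≤ n p≤))
    (≤-trans (≤-reflexive (*-comm 20 t)) (m/n*n≤m (suc l * n) 20))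
    (few-inversions n hs t)
  -- This is Markov's inequality doubled. By `2c≤n!` the inputs with few inversions account for at
  -- most one of the two copies of `suc t * n !`, which the caller cancels.
  twice : suc t * n ! + suc t * n ! ≤ 2 * S + suc t * n !
  twice = begin
    suc t * n ! + suc t * n !    ≡⟨ cong (suc t * n ! +_) (+-identityʳ _) ⟨
    2 * (suc t * n !)            ≡⟨ cong (λ m → 2 * (suc t * m)) (length-permutations n) ⟨
    2 * (suc t * length (permutations n))  ≤⟨ *-monoʳ-≤ 2 (markov (inversions (hs ++ [ 1 ])) t (permutations n)) ⟩
    2 * (S + suc t * c)          ≡⟨ reorder S (suc t) c ⟩
    2 * S + suc t * (2 * c)      ≤⟨ +-monoʳ-≤ (2 * S) (*-monoʳ-≤ (suc t) 2c≤n!) ⟩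
    2 * S + suc t * n !          ∎
    where
    reorder : ∀ s t c → 2 * (s + t * c) ≡ 2 * s + t * (2 * c)
    reorder = solve-∀

-- This is (n/80) · log n ≤ average with denominators cleared. Replacing log n by its floor L costs
-- a factor 2, as log n < 1 + L ≤ 2L; this turns 40 into 80.
n^n*n!≤ : ∀ n hs → 256 ≤ n → length (hs ++ [ 1 ]) ≤ suc ⌊log₂ n ⌋ →
  n ^ (n * n !) ≤ 2 ^ (sum (map (inversions (hs ++ [ 1 ])) (permutations n)) * 80)
n^n*n!≤ n hs 256≤n p≤ = begin
  n ^ (n * n !)             ≤⟨ ^-monoˡ-≤ (n * n !) (<⇒≤ (n<2^[1+⌊log₂n⌋] n)) ⟩
  (2 ^ suc L) ^ (n * n !)   ≡⟨ ^-*-assoc 2 (suc L) (n * n !) ⟩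
  2 ^ (suc L * (n * n !))   ≤⟨ ^-monoʳ-≤ 2 (begin
    suc L * (n * n !)         ≤⟨ *-monoˡ-≤ (n * n !) (+-monoˡ-≤ L 1≤L) ⟩
    (L + L) * (n * n !)       ≡⟨ reorder L n (n !) ⟩
    2 * (L * n * n !)         ≤⟨ *-monoʳ-≤ 2 (total-inversions n hs 256≤n p≤) ⟩
    2 * (40 * S)              ≡⟨ *-assoc 2 40 S ⟨
    80 * S                    ≡⟨ *-comm 80 S ⟩
    S * 80                    ∎) ⟩
  2 ^ (S * 80)              ∎
  where
  open ≤-Reasoning
  L = ⌊log₂ n ⌋
  S = sum (map (inversions (hs ++ [ 1 ])) (permutations n))
  1≤L : 1 ≤ L
  1≤L = ⌊log₂⌋-mono-≤ {2} (≤-trans (s≤s (s≤s z≤n)) 256≤n)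
  reorder : ∀ l n m → (l + l) * (n * m) ≡ 2 * (l * n * m)
  reorder = solve-∀

endsWith1⇒Ω : ∀ (hs : ℕ → List ℕ) →
  (∀ n → 256 ≤ n → ∃[ hs′ ] hs n ≡ hs′ ++ [ 1 ] × length (hs n) ≤ suc ⌊log₂ n ⌋) →
  Ω[n·log₂n] (λ n → averageInversions n (hs n))
-- The constant is 1/80: `mkℚᵘ` takes the denominator minus one.
endsWith1⇒Ω hs ends = mkℚᵘ (ℤ.+ 1) 79 , _ , 256 , bound
  where
  bound : ∀ n → 256 ≤ n → (mkℚᵘ (ℤ.+ 1) 79 ℚᵘ.* (ℤ.+ n ℚᵘ./ 1)) ·log₂ n ≤ averageInversions n (hs n)
  bound n 256≤n with hs n | ends n 256≤n
  ... | _ | hs′ , refl , p≤ = subst₂ (λ a b → n ^ a ≤ 2 ^ b)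
    (cong₂ _*_ (sym (trans (ℤ.abs-* (ℤ.+ 1) (ℤ.+ n)) (*-identityˡ n))) (sym (ℤ.+-injective (ℚᵘ.↧[n/d]≡d (ℤ.+ S) (n !) {{n !≢0}}))))
    (cong (_* 80) (sym (cong ∣_∣ (ℚᵘ.↥[n/d]≡n (ℤ.+ S) (n !) {{n !≢0}}))))
    (n^n*n!≤ n hs′ 256≤n p≤)
    where S = sum (map (inversions (hs′ ++ [ 1 ])) (permutations n))

-- The increment sequences

-- If `f (suc k) < n`, then 2 ^ k < n < 2 ^ (1 + L) for the floor L of log n, so `k` is one of 0,
-- ..., L. The entry `f 1 = 1` passes the filter first and is last after the reversal.
exponential-ends : ∀ (f : ℕ → ℕ) → f 1 ≡ 1 → (∀ k → 2 ^ k ≤ f (suc k)) → ∀ n → 256 ≤ n →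
  let hs = reverse (filter (_<? n) (map f [1⋯ n ])) in
  ∃[ hs′ ] hs ≡ hs′ ++ [ 1 ] × length hs ≤ suc ⌊log₂ n ⌋
exponential-ends f f1≡1 2^k≤f n@(suc m) 256≤n = _ , ends , short
  where
  short : length (reverse (filter (_<? n) (map f [1⋯ n ]))) ≤ suc ⌊log₂ n ⌋
  short = begin
    length (reverse (filter (_<? n) (map f [1⋯ n ])))  ≡⟨ length-reverse (filter (_<? n) (map f [1⋯ n ])) ⟩
    length (filter (_<? n) (map f [1⋯ n ]))            ≡⟨ cong (length ∘ filter (_<? n)) (map-∘ {g = f} {suc} (upTo n)) ⟨
    length (filter (_<? n) (map (f ∘ suc) (upTo n)))   ≡⟨ cong length (filter-map (_<? n) (f ∘ suc) (upTo n)) ⟩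
    length (map (f ∘ suc) ks)                          ≡⟨ length-map (f ∘ suc) ks ⟩
    length ks                                          ≤⟨ unique-⊆⇒length-≤ (Unique.filter⁺ small? (Unique.upTo⁺ n)) small ⟩
    length (upTo (suc ⌊log₂ n ⌋))                      ≡⟨ length-upTo (suc ⌊log₂ n ⌋) ⟩
    suc ⌊log₂ n ⌋                                      ∎
    where
    open ≤-Reasoning
    small? = λ k → f (suc k) <? n
    ks = filter small? (upTo n)
    small : ∀ {k} → k ∈ ks → k ∈ upTo (suc ⌊log₂ n ⌋)
    small {k} k∈ = ∈-upTo⁺ (≰⇒> λ L<k → <⇒≱ (<-trans (≤-<-trans (2^k≤f k) (proj₂ (∈-filter⁻ small? {xs = upTo n} k∈))) (n<2^[1+⌊log₂n⌋] n))
      (^-monoʳ-≤ 2 L<k))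

  hs = filter (_<? n) (map f (map suc (applyUpTo suc m)))
  ends : reverse (filter (_<? n) (map f [1⋯ n ])) ≡ reverse hs ++ [ 1 ]
  ends rewrite f1≡1 | filter-accept (_<? n) {1} {map f (map suc (applyUpTo suc m))} (≤-trans (s≤s (s≤s z≤n)) 256≤n) = unfold-reverse 1 hs

length-[1⋯] : ∀ m → length [1⋯ m ] ≡ m
length-[1⋯] m = trans (length-map suc (upTo m)) (length-upTo m)

papernovStasevich-Ω : Ω[n·log₂n] (λ n → averageInversions n (papernovStasevich n))
papernovStasevich-Ω = endsWith1⇒Ω papernovStasevich λ n _ → _ , refl , (begin
  length (papernovStasevich n)                     ≡⟨ length-++ (map (λ k → ⌊ n /2^ k ⌋ + 1) [1⋯ ⌊log₂ n ⌋ ∸ 1 ]) ⟩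
  length (map (λ k → ⌊ n /2^ k ⌋ + 1) [1⋯ ⌊log₂ n ⌋ ∸ 1 ]) + 1 ≡⟨ cong (_+ 1) (trans (length-map _ [1⋯ ⌊log₂ n ⌋ ∸ 1 ]) (length-[1⋯] (⌊log₂ n ⌋ ∸ 1))) ⟩
  ⌊log₂ n ⌋ ∸ 1 + 1                                ≤⟨ +-monoˡ-≤ 1 (m∸n≤m ⌊log₂ n ⌋ 1) ⟩
  ⌊log₂ n ⌋ + 1                                    ≡⟨ +-comm ⌊log₂ n ⌋ 1 ⟩
  suc ⌊log₂ n ⌋                                    ∎)
  where open ≤-Reasoning

hibbard-Ω : Ω[n·log₂n] (λ n → averageInversions n (hibbard n))
hibbard-Ω = endsWith1⇒Ω hibbard (exponential-ends (λ k → 2 ^ k ∸ 1) refl 2^k≤)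
  where
  2^k≤ : ∀ k → 2 ^ k ≤ 2 ^ suc k ∸ 1
  2^k≤ k = m+n≤o⇒m≤o∸n (2 ^ k) (+-monoʳ-≤ (2 ^ k) (≤-trans (m^n>0 2 k) (≤-reflexive (sym (+-identityʳ (2 ^ k))))))

pratt-Ω : Ω[n·log₂n] (λ n → averageInversions n (pratt n))
pratt-Ω = endsWith1⇒Ω pratt (exponential-ends (λ k → (3 ^ k ∸ 1) / 2) refl 2^k≤)
  where
  open ≤-Reasoning
  -- The doubled inequality is 2 · 2^k + 1 ≤ 2 · 3^k + 3^k = 3^(k+1).
  2^k≤ : ∀ k → 2 ^ k ≤ (3 ^ suc k ∸ 1) / 2
  2^k≤ k = begin
    2 ^ k                 ≡⟨ m*n/n≡m (2 ^ k) 2 ⟨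
    2 ^ k * 2 / 2         ≤⟨ /-monoˡ-≤ 2 (m+n≤o⇒m≤o∸n (2 ^ k * 2) (begin
      2 ^ k * 2 + 1         ≤⟨ +-mono-≤ (*-monoˡ-≤ 2 (^-monoˡ-≤ k (n≤1+n 2))) (m^n>0 3 k) ⟩
      3 ^ k * 2 + 3 ^ k     ≡⟨ triple (3 ^ k) ⟩
      3 ^ suc k             ∎)) ⟩
    (3 ^ suc k ∸ 1) / 2   ∎
    where
    triple : ∀ x → x * 2 + x ≡ 3 * x
    triple = solve-∀

-- The last increment is 1 because 2 ^ L ≤ n < 2 ^ (1 + L) for the floor L of log n.
shell-Ω : Ω[n·log₂n] (λ n → averageInversions n (shell n))
shell-Ω = endsWith1⇒Ω shell λ n 256≤n → ends n {{>-nonZero (≤-trans (s≤s z≤n) 256≤n)}} (≤-trans (s≤s (s≤s z≤n)) 256≤n)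
  where
  ends : ∀ n .{{_ : NonZero n}} → 2 ≤ n → ∃[ hs ] shell n ≡ hs ++ [ 1 ] × length (shell n) ≤ suc ⌊log₂ n ⌋
  ends n 2≤n with ⌊log₂ n ⌋ | ⌊log₂⌋-mono-≤ 2≤n | 2^⌊log₂n⌋≤n n | n<2^[1+⌊log₂n⌋] n
  -- `2 ≤ n` rules out logarithm 0, for which the sequence would be empty.
  ... | suc l | _ | 2^L≤n | n<2^1+L = map half (map suc (upTo l)) , last , short
    where
    open ≡-Reasoning
    half = λ k → ⌊ n /2^ k ⌋
    n/2^L≡1 : half (suc l) ≡ 1
    n/2^L≡1 = ≤-antisym (s≤s⁻¹ (m<n*o⇒m/o<n {n} {2} {2 ^ suc l} {{m^n≢0 2 (suc l)}} n<2^1+L)) (m≥n⇒m/n>0 {n} {2 ^ suc l} {{m^n≢0 2 (suc l)}} 2^L≤n)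
    last : map half [1⋯ suc l ] ≡ map half [1⋯ l ] ++ [ 1 ]
    last = begin
      map half [1⋯ suc l ]                   ≡⟨ cong (map half ∘ map suc) (upTo-∷ʳ l) ⟨
      map half (map suc (upTo l ++ [ l ]))   ≡⟨ cong (map half) (map-++ suc (upTo l) [ l ]) ⟩
      map half ([1⋯ l ] ++ [ suc l ])        ≡⟨ map-++ half [1⋯ l ] [ suc l ] ⟩
      map half [1⋯ l ] ++ [ half (suc l) ]   ≡⟨ cong (λ h → map half [1⋯ l ] ++ [ h ]) n/2^L≡1 ⟩
      map half [1⋯ l ] ++ [ 1 ]              ∎
    short : length (map half [1⋯ suc l ]) ≤ 2+ l
    short = ≤-trans (≤-reflexive (trans (length-map half [1⋯ suc l ]) (length-[1⋯] (suc l)))) (n≤1+n (suc l))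

corollary2 : Ω[n·log₂n] (λ n → averageInversions n (papernovStasevich n)) ×
    Ω[n·log₂n] (λ n → averageInversions n (hibbard n)) ×
    Ω[n·log₂n] (λ n → averageInversions n (pratt n)) ×
    Ω[n·log₂n] (λ n → averageInversions n (shell n))
corollary2 = papernovStasevich-Ω , hibbard-Ω , pratt-Ω , shell-Ω
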